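{- Let $\Lambda>0$. For a prime power $q$, let $\Gamma_q$ be a strongly regular graph with parameters $v=q^4$, $k=(q-1)^2(q^2+1)$, $\mu=(q-1)^2((q-1)^2+1)$, $\lambda=\mu+(q-1)^2+1-2q$ (whose restricted eigenvalues are $\rho=(q-1)^2$ and $\sigma=1-2q$). Then there are infinitely many prime powers $q$ such that for every integer $d$ with $0\le d\le\Lambda$, $$\mathrm{Rab}_{\geq}(\Gamma_q,d)<\lfloor \mathrm{Haem}_{\geq}(\Gamma_q,d)\rfloor.$$
   Context: A graph is strongly regular with parameters $(v,k,\lambda,\mu)$ if it has $v$ vertices, is $k$-regular, is neither complete nor edgeless, every two adjacent vertices have exactly $\lambda$ common neighbours, and every two distinct non-adjacent vertices have exactly $\mu$ common neighbours; restricted eigenvalues $\rho>\sigma$ are the roots of $t^2-(\lambda-\mu)t-(k-\mu)=0$. Strongly regular graphs with the parameters of $\Gamma_q$ exist for every prime power $q$ (Calderbank–Kantor, Example CY1). Both bounds below depend only on the parameters. $\mathrm{Haem}_{\geq}(\Gamma,d)=v\frac{d-\sigma}{k-\sigma}$; $R_\Gamma(x,y,d)=x(x+1)(v-y)-2xyk+(2x+\lambda-\mu+1)yd+y(y-1)\mu-yd^2$; $S_d=\{y\in\{d+1,\dots,v\}: R_\Gamma(x,y,d)\ge0\text{ for all integers }x\}$; $\mathrm{Rab}_{\geq}(\Gamma,d)=\max S_d$ if $S_d\ne\emptyset$, else $0$. -}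

module Defs where

open import Data.Nat as ℕ using (ℕ; suc)
open import Data.Nat.Primality using (Prime)
open import Data.Integer as ℤ using (ℤ; +_)
open import Data.Rational as ℚ using (ℚ; 0ℚ; _÷_; ≢-nonZero)
open import Data.Rational.Properties using (_≟_)
open import Data.Product using (Σ; ∃; _×_; _,_)
open import Data.Sum using (_⊎_)
open import Relation.Nullary using (¬_; yes; no)
open import Relation.Binary.PropositionalEquality using (_≡_)

IsPrimePower : ℕ → Set
IsPrimePower q = Σ ℕ λ p → Σ ℕ λ m → Prime p × (q ≡ p ℕ.^ suc m)

-- Parameters (v,k,λ,μ) of a strongly regular graph, together with its
-- restricted eigenvalue σ (the smaller root of t² - (λ-μ)t - (k-μ)).
record SRGParams : Set where
  constructor srg
  field
    v k lam mu σ : ℤ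

open SRGParams public

Γ : ℕ → SRGParams
Γ q = srg vq kq (muq ℤ.+ (qm1 ℤ.^ 2) ℤ.+ + 1 ℤ.- + 2 ℤ.* + q) muq (+ 1 ℤ.- + 2 ℤ.* + q)
  where
  qm1 : ℤ
  qm1 = + q ℤ.- + 1
  vq : ℤ
  vq = (+ q) ℤ.^ 4
  kq : ℤ
  kq = (qm1 ℤ.^ 2) ℤ.* ((+ q) ℤ.^ 2 ℤ.+ + 1)
  muq : ℤ
  muq = (qm1 ℤ.^ 2) ℤ.* ((qm1 ℤ.^ 2) ℤ.+ + 1)

fromℤ : ℤ → ℚ
fromℤ z = z ℚ./ 1

-- rational division, with the (unused here) convention p / 0 = 0
_divℚ_ : ℚ → ℚ → ℚ
p divℚ r with r ≟ 0ℚ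
... | yes _ = 0ℚ
... | no r≢0 = _÷_ p r {{≢-nonZero r≢0}}

Haem : SRGParams → ℤ → ℚ
Haem P d = (fromℤ (v P) ℚ.* fromℤ (d ℤ.- σ P)) divℚ fromℤ (k P ℤ.- σ P)

R : SRGParams → ℤ → ℤ → ℤ → ℤ
R P x y d =
  x ℤ.* (x ℤ.+ + 1) ℤ.* (v P ℤ.- y)
  ℤ.- + 2 ℤ.* x ℤ.* y ℤ.* k P
  ℤ.+ (+ 2 ℤ.* x ℤ.+ lam P ℤ.- mu P ℤ.+ + 1) ℤ.* y ℤ.* d
  ℤ.+ y ℤ.* (y ℤ.- + 1) ℤ.* mu P
  ℤ.- y ℤ.* d ℤ.* d

InS : SRGParams → ℤ → ℤ → Set
InS P d y = (d ℤ.+ + 1 ℤ.≤ y) × (y ℤ.≤ v P) × (∀ (x : ℤ) → + 0 ℤ.≤ R P x y d)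

RabIs : SRGParams → ℤ → ℤ → Set
RabIs P d r =
  (InS P d r × (∀ y → InS P d y → y ℤ.≤ r))
  ⊎ ((∀ y → ¬ InS P d y) × (r ≡ + 0))

{-# OPTIONS --safe #-}
module Submission where

-- Write n = v - y, M = y (k - d) and E = y (k - d)² - n (k - μ + (λ - μ) d - d² + y μ).
-- Completing the square at x = ⌊M / n⌋, with remainder r = M - x n, gives
-- n R(x,y,d) = - (r (n - r) + y E), so y ∉ S_d as soon as E > 0.  For Γ_q this E is the product
-- of two linear forms in y, with roots Haem and a negative number, so S_d lies below Haem.
-- For q ≥ 2d + 4 one has Haem = 2q + d + 3 + 2((d+1)q - d - 3) / (q² - 2q + 2), whose floor is
-- at least 2q + d + 3.  At y = 2q + d + 3 itself E is slightly negative, but M / n lies about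
-- 2(d+1)/q below the integer 2q + d - 1, so that n · (r/n)(1 - r/n) ≈ 2(d+1)q³ wins:
-- R(2q + d - 2, 2q + d + 3, d) < 0.

open import Defs
open import Data.Nat as ℕ using (ℕ; zero; suc; z≤n; z<s)
import Data.Nat.Properties as ℕP
open import Data.Nat.Primality using (prime[2])
open import Data.Integer as ℤ using (ℤ; +_; -[1+_]; +[1+_]; +≤+; +<+; -≤+; -<+; _≤_; _<_; _+_; _-_; _*_; -_; ∣_∣)
open import Data.Integer.Properties
open import Data.Integer.DivMod using (n%ℕd<d; a≡a%ℕn+[a/ℕn]*n; n<s[n/ℕd]*d; div-pos-is-/ℕ)
open import Data.Integer.Tactic.RingSolver using (solve-∀)
open import Data.Rational as ℚ using (ℚ; 0ℚ; _÷_; 1/_; mkℚ; ↥_; ↧_; toℚᵘ)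
import Data.Rational.Properties as ℚP
open import Data.Rational.Unnormalised as ℚᵘ using (mkℚᵘ; *≤*)
import Data.Rational.Unnormalised.Properties as ℚᵘP
open import Data.Product using (Σ; _×_; _,_)
open import Data.Sum using (inj₁; inj₂)
open import Relation.Nullary using (¬_; yes; no; contradiction)
open import Relation.Binary.PropositionalEquality using (_≡_; refl; sym; trans; cong; subst; subst₂)

-- Signs of integer polynomials

infixl 6 _≥+≥_ _≥+>_
infixl 7 _≥*≥_ _>*>_

-- The marks around each operator tell which operands are nonnegative and which positive; with
-- fixities matching + and *, a sign proof is spelled like the polynomial it is about.
_≥+≥_ : ∀ {i j} → + 0 ≤ i → + 0 ≤ j → + 0 ≤ i + j
_≥+≥_ = +-mono-≤

_≥+>_ : ∀ {i j} → + 0 ≤ i → + 0 < j → + 0 < i + j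
_≥+>_ = +-mono-≤-<

_≥*≥_ : ∀ {i j} → + 0 ≤ i → + 0 ≤ j → + 0 ≤ i * j
_≥*≥_ {+ m} {+ n} _ _ = subst (+ 0 ≤_) (pos-* m n) (+≤+ z≤n)

_>*>_ : ∀ {i j} → + 0 < i → + 0 < j → + 0 < i * j
_>*>_ {+[1+ m ]} {+[1+ n ]} _ _ = +<+ z<s
_>*>_ {+ 0} (+<+ ())
_>*>_ {+[1+ m ]} {+ 0} _ (+<+ ())

0≤+ : ∀ {n} → + 0 ≤ + n
0≤+ = +≤+ z≤n

above : ∀ i → Σ ℤ λ j → (+ 0 ≤ j) × (i < j)
above (+ n)    = + suc n , 0≤+ , +<+ (ℕP.n<1+n n)
above -[1+ n ] = + 0 , 0≤+ , -<+

i<j⇒0<j-i : ∀ {i j} → i < j → + 0 < j - i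
i<j⇒0<j-i {i} {j} i<j = subst (_< j - i) (+-inverseʳ i) (+-monoˡ-< (- i) i<j)

division : ∀ i n → + 0 < n → Σ ℤ λ x → (+ 0 ≤ i - x * n) × (i - x * n ≤ n)
division i (+ 0) (+<+ ())
division i n@(+[1+ n-1 ]) _ =
  x , subst (+ 0 ≤_) (sym i-xn≡r) 0≤+
    , subst (_≤ n) (sym i-xn≡r) (<⇒≤ (+<+ (n%ℕd<d i (suc n-1))))
  where
  x = i ℤ./ℕ suc n-1
  r = i ℤ.%ℕ suc n-1
  cancel : ∀ a b → a + b - b ≡ a
  cancel = solve-∀
  i-xn≡r : i - x * n ≡ + r
  i-xn≡r = trans (cong (_- x * n) (a≡a%ℕn+[a/ℕn]*n i (suc n-1))) (cancel (+ r) (x * n))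

-- Excluding y from S_d for arbitrary parameters

R-complete-square : ∀ v k l m x y d →
  (v - y) * (x * (x + + 1) * (v - y) - + 2 * x * y * k + (+ 2 * x + l - m + + 1) * y * d
             + y * (y - + 1) * m - y * d * d)
  ≡ - ((y * (k - d) - x * (v - y)) * ((v - y) - (y * (k - d) - x * (v - y)))
       + y * (y * ((k - d) * (k - d)) - (v - y) * (k - m + (l - m) * d - d * d + y * m)))
R-complete-square = solve-∀

-- At y = v the quadratic term in x vanishes, leaving a line of slope -2 v (k - d). One x is split
-- off so that, when k > d, the bracket is positive as soon as x ≥ 0 exceeds the constant subtracted
-- from it.
R-at-v : ∀ v k l m x d →
  x * (x + + 1) * (v - v) - + 2 * x * v * k + (+ 2 * x + l - m + + 1) * v * d
    + v * (v - + 1) * m - v * d * d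
  ≡ - (v * (x * (+ 1 + + 2 * (k - d - + 1)) + (x - ((l - m + + 1) * d + (v - + 1) * m - d * d))))
R-at-v = solve-∀

0<-i⇒i≱0 : ∀ {i j} → i ≡ - j → + 0 < j → ¬ (+ 0 ≤ i)
0<-i⇒i≱0 refl 0<j 0≤i = <⇒≱ (neg-mono-< 0<j) 0≤i

E : SRGParams → ℤ → ℤ → ℤ
E P y d = y * ((k P - d) * (k P - d))
          - (v P - y) * (k P - mu P + (lam P - mu P) * d - d * d + y * mu P)

v∉S : ∀ P d → + 0 < v P → + 0 < k P - d → ¬ (∀ x → + 0 ≤ R P x (v P) d)
v∉S P d 0<v 0<k-d R≥0 with above ((lam P - mu P + + 1) * d + (v P - + 1) * mu P - d * d)
... | x , 0≤x , C<x = 0<-i⇒i≱0 (R-at-v (v P) (k P) (lam P) (mu P) x d) 0<-R (R≥0 x)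
  where
  0≤k-d-1 = i≤j⇒0≤j-i (i<j⇒suc[i]≤j 0<k-d)
  0<-R = 0<v >*> (0≤x ≥*≥ (0≤+ {1} ≥+≥ 0≤+ {2} ≥*≥ 0≤k-d-1) ≥+> i<j⇒0<j-i C<x)

<v∧E>0⇒∉S : ∀ P y d → + 0 < y → y < v P → + 0 < E P y d → ¬ (∀ x → + 0 ≤ R P x y d)
<v∧E>0⇒∉S P y d 0<y y<v 0<E R≥0
  with division (y * (k P - d)) (v P - y) (i<j⇒0<j-i y<v)
... | x , 0≤r , r≤n =
  0<-i⇒i≱0 (R-complete-square (v P) (k P) (lam P) (mu P) x y d) 0<-nR (0≤n ≥*≥ R≥0 x)
  where
  0≤n = i≤j⇒0≤j-i (<⇒≤ y<v)
  0≤n-r = i≤j⇒0≤j-i r≤n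
  0<-nR = 0≤r ≥*≥ 0≤n-r ≥+> 0<y >*> 0<E

-- The endpoint y = v has n = 0 and admits no division by n; it goes through `v∉S`, where a large x
-- makes R negative.
E>0⇒∉S : ∀ P y d → + 0 < y → + 0 < k P - d → + 0 < E P y d → ¬ InS P d y
E>0⇒∉S P y d 0<y 0<k-d 0<E (_ , y≤v , R≥0) =
  <v∧E>0⇒∉S P y d 0<y (≤∧≢⇒< y≤v y≢v) 0<E R≥0
  where
  y≢v : ¬ (y ≡ v P)
  y≢v y≡v = v∉S P d (subst (+ 0 <_) y≡v 0<y) 0<k-d
    (λ x → subst (λ y → + 0 ≤ R P x y d) y≡v (R≥0 x))

-- Powers are spelled out as in the unfolding of ℤ._^_, which the ring solver cannot see through.
E-Γ : ∀ q y d →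
  let p² = (q - + 1) * ((q - + 1) * + 1)
      q² = q * (q * + 1)
      v = q * (q * q²)
      k = p² * (q² + + 1)
      m = p² * (p² + + 1)
      l = m + p² + + 1 - + 2 * q
  in y * ((k - d) * (k - d)) - (v - y) * (k - m + (l - m) * d - d * d + y * m)
     ≡ ((p² + + 1) * (y - (+ 2 * q + d + + 4)) + q * (q - (+ 2 * d + + 4)) + + 2 * d + + 8)
       * (q² * (p² - d) + p² * y)
E-Γ = solve-∀

-- Serves to show d < p²: for q ≥ 2d + 4 each of p, s and d is nonnegative, and the constant 9 makes
-- the sum positive.
p²-d-expand : ∀ q d →
  let p = q - + 1
      s = q - (+ 2 * d + + 4)
  in p * (p * + 1) - d ≡ p * s + + 2 * d * p + + 3 * s + + 5 * d + + 9
p²-d-expand = solve-∀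

k-d-expand : ∀ p² q² d → p² * (q² + + 1) - d ≡ p² * q² + (p² - d)
k-d-expand = solve-∀

-- In terms of s = q - (2d + 4) every coefficient of -R is nonnegative.
R-at-2q+d+3 : ∀ q d →
  let x = + 2 * q + d - + 2
      y = + 2 * q + d + + 3
      p² = (q - + 1) * ((q - + 1) * + 1)
      q² = q * (q * + 1)
      v = q * (q * q²)
      k = p² * (q² + + 1)
      m = p² * (p² + + 1)
      l = m + p² + + 1 - + 2 * q
      s = q - (+ 2 * d + + 4)
  in x * (x + + 1) * (v - y) - + 2 * x * y * k + (+ 2 * x + l - m + + 1) * y * d
       + y * (y - + 1) * m - y * d * d
     ≡ - ((((+ 2 * d + + 2) * s + (+ 8 * d * d + + 22 * d + + 10)) * s
           + (+ 8 * d * d * d + + 38 * d * d + + 52 * d + + 14)) * s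
          + (+ 4 * d * d * d + + 22 * d * d + + 32 * d) + + 6)
R-at-2q+d+3 = solve-∀

-- This is Haem ≥ 2q + d + 3 with the denominator k - σ cleared: for d ≥ 0 and s ≥ 0 the right side
-- is visibly nonnegative.
Haem-Γ-gap : ∀ q d →
  let p² = (q - + 1) * ((q - + 1) * + 1)
      q² = q * (q * + 1)
      s = q - (+ 2 * d + + 4)
  in q * (q * q²) * (d - (+ 1 - + 2 * q))
     - (+ 2 * q + d + + 3) * (p² * (q² + + 1) - (+ 1 - + 2 * q))
     ≡ + 2 * q * q * ((d + + 1) * s + + 2 * d * d + + 5 * d + + 1)
Haem-Γ-gap = solve-∀

k-σ-Γ : ∀ q →
  let p² = (q - + 1) * ((q - + 1) * + 1)
      q² = q * (q * + 1)
  in p² * (q² + + 1) - (+ 1 - + 2 * q) ≡ q * q * (p² + + 1)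
k-σ-Γ = solve-∀

-- Integers among the rationals, division and floors

-- `fromℤ` normalises by a gcd that is stuck on a variable, so order and products are transferred
-- through the unnormalised z/1.
toℚᵘ-fromℤ : ∀ z → toℚᵘ (fromℤ z) ℚᵘ.≃ mkℚᵘ z 0
toℚᵘ-fromℤ z = ℚP.toℚᵘ-fromℚᵘ (mkℚᵘ z 0)

fromℤ-mono-≤ : ∀ {i j} → i ≤ j → fromℤ i ℚ.≤ fromℤ j
fromℤ-mono-≤ {i} {j} i≤j = ℚP.toℚᵘ-cancel-≤
  (ℚᵘP.≤-respˡ-≃ (ℚᵘP.≃-sym (toℚᵘ-fromℤ i)) (ℚᵘP.≤-respʳ-≃ (ℚᵘP.≃-sym (toℚᵘ-fromℤ j))
    (*≤* (*-monoʳ-≤-nonNeg (+ 1) i≤j))))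

fromℤ-homo-* : ∀ i j → fromℤ (i * j) ≡ fromℤ i ℚ.* fromℤ j
fromℤ-homo-* i j = ℚP.toℚᵘ-injective
  (ℚᵘP.≃-trans (toℚᵘ-fromℤ (i * j))
  (ℚᵘP.≃-sym (ℚᵘP.≃-trans (ℚP.toℚᵘ-homo-* (fromℤ i) (fromℤ j))
    (ℚᵘP.*-cong (toℚᵘ-fromℤ i) (toℚᵘ-fromℤ j)))))

fromℤ≤⇒*↧≤↥ : ∀ z p → fromℤ z ℚ.≤ p → z * ↧ p ≤ ↥ p
fromℤ≤⇒*↧≤↥ z p@record{} z≤p
  with *≤* le ← ℚᵘP.≤-respˡ-≃ (toℚᵘ-fromℤ z) (ℚP.toℚᵘ-mono-≤ z≤p)
  = subst (z * ↧ p ≤_) (*-identityʳ (↥ p)) le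

-- For p = n/b one has z b ≤ n < (⌊n/b⌋ + 1) b, and the positive b cancels.
fromℤ≤⇒≤floor : ∀ z p → fromℤ z ℚ.≤ p → z ≤ ℚ.floor p
fromℤ≤⇒≤floor z p@(mkℚ n d-1 _) z≤p =
  subst (z ≤_) (sym (div-pos-is-/ℕ n (suc d-1)))
    (subst (z ≤_) (pred-suc (n ℤ./ℕ suc d-1))
      (i<j⇒i≤pred[j] (*-cancelʳ-<-nonNeg {z} {ℤ.suc (n ℤ./ℕ suc d-1)} (+ suc d-1)
        (≤-<-trans (fromℤ≤⇒*↧≤↥ z p z≤p) (n<s[n/ℕd]*d n (suc d-1))))))

-- The denominator is at least 1, so the numerator alone gives a crude natural-number bound; this is
-- how Λ bounds d.
fromℤ≤⇒≤∣↥∣ : ∀ z p → + 0 ≤ z → fromℤ z ℚ.≤ p → z ≤ + ∣ ↥ p ∣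
fromℤ≤⇒≤∣↥∣ z@(+ n) p@(mkℚ a b-1 _) _ z≤p =
  ≤-trans (i≤i*j n b-1) (≤-trans (fromℤ≤⇒*↧≤↥ z p z≤p) (i≤∣i∣ a))
  where
  i≤∣i∣ : ∀ i → i ≤ + ∣ i ∣
  i≤∣i∣ (+ n)    = ≤-refl
  i≤∣i∣ -[1+ n ] = -≤+
  i≤i*j : ∀ n m → + n ≤ + n * +[1+ m ]
  i≤i*j n m = subst (+ n ≤_) (pos-* n (suc m)) (+≤+ (ℕP.m≤m*n n (suc m)))

1/pos⇒nonNeg : ∀ p .{{_ : ℚ.NonZero p}} .{{_ : ℚ.Positive p}} → ℚ.NonNegative (1/ p)
1/pos⇒nonNeg (mkℚ +[1+ _ ] _ _) = _

≤-÷ : ∀ x a b .{{_ : ℚ.NonZero b}} .{{_ : ℚ.Positive b}} → x ℚ.* b ℚ.≤ a → x ℚ.≤ a ÷ b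
≤-÷ x a b xb≤a = subst (ℚ._≤ a ÷ b) eq
  (ℚP.*-monoʳ-≤-nonNeg (1/ b) {{1/pos⇒nonNeg b}} xb≤a)
  where
  eq : x ℚ.* b ℚ.* 1/ b ≡ x
  eq = trans (ℚP.*-assoc x b (1/ b))
             (trans (cong (x ℚ.*_) (ℚP.*-inverseʳ b)) (ℚP.*-identityʳ x))

≤-divℚ : ∀ x a b → ℚ.Positive b → x ℚ.* b ℚ.≤ a → x ℚ.≤ a divℚ b
≤-divℚ x a b b>0 xb≤a with b ℚP.≟ 0ℚ
-- Positivity of b rules out the branch where `_divℚ_` returns its default 0.
... | yes refl = contradiction (ℚP.positive⁻¹ b {{b>0}}) (ℚP.<-irrefl refl)
... | no b≢0   = ≤-÷ x a b {{ℚ.≢-nonZero b≢0}} {{b>0}} xb≤a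

fromℤ-positive : ∀ {i} → + 0 < i → ℚ.Positive (fromℤ i)
fromℤ-positive {+[1+ n ]} _ = ℚP.normalize-pos (suc n) 1
fromℤ-positive {+ 0} (+<+ ())

≤floor-Haem : ∀ P d z → + 0 < k P - σ P → z * (k P - σ P) ≤ v P * (d - σ P) →
              z ≤ ℚ.floor (Haem P d)
≤floor-Haem P d z k>σ zb≤a = fromℤ≤⇒≤floor z (Haem P d)
  (≤-divℚ _ _ _ (fromℤ-positive k>σ)
    (subst₂ ℚ._≤_ (fromℤ-homo-* z (k P - σ P)) (fromℤ-homo-* (v P) (d - σ P))
      (fromℤ-mono-≤ zb≤a)))

-- Both bounds for Γ_q when q ≥ 2d + 4

module _ (q : ℕ) (d : ℤ) (0≤d : + 0 ≤ d) (2d+4≤q : + 2 * d + + 4 ≤ + q) where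

  private
    p : ℤ
    p = + q - + 1

    0≤s : + 0 ≤ + q - (+ 2 * d + + 4)
    0≤s = i≤j⇒0≤j-i 2d+4≤q

    0<q : + 0 < + q
    0<q = <-≤-trans (0≤+ {2} ≥*≥ 0≤d ≥+> +<+ z<s) 2d+4≤q

    0≤q : + 0 ≤ + q
    0≤q = 0≤+

    0≤p : + 0 ≤ p
    0≤p = i≤j⇒0≤j-i (i<j⇒suc[i]≤j 0<q)

    0≤p² : + 0 ≤ p ℤ.^ 2
    0≤p² = 0≤p ≥*≥ (0≤p ≥*≥ 0≤+ {1})

    0<p²-d : + 0 < p ℤ.^ 2 - d
    0<p²-d = subst (+ 0 <_) (sym (p²-d-expand (+ q) d))
      (0≤p ≥*≥ 0≤s ≥+≥ 0≤+ {2} ≥*≥ 0≤d ≥*≥ 0≤p ≥+≥ 0≤+ {3} ≥*≥ 0≤s ≥+≥ 0≤+ {5} ≥*≥ 0≤d ≥+> +<+ z<s)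

    0<k-d : + 0 < k (Γ q) - d
    0<k-d = subst (+ 0 <_) (sym (k-d-expand (p ℤ.^ 2) ((+ q) ℤ.^ 2) d))
      (0≤p² ≥*≥ (0≤q ≥*≥ (0≤q ≥*≥ 0≤+ {1})) ≥+> 0<p²-d)

  2q+d+3≤⌊Haem⌋ : + 2 * + q + d + + 3 ≤ ℚ.floor (Haem (Γ q) d)
  2q+d+3≤⌊Haem⌋ = ≤floor-Haem (Γ q) d _
    (subst (+ 0 <_) (sym (k-σ-Γ (+ q))) (0<q >*> 0<q >*> (0≤p² ≥+> +<+ z<s)))
    (0≤i-j⇒j≤i (subst (+ 0 ≤_) (sym (Haem-Γ-gap (+ q) d))
      (0≤+ {2} ≥*≥ 0≤q ≥*≥ 0≤q ≥*≥
        ((0≤d ≥+≥ 0≤+ {1}) ≥*≥ 0≤s ≥+≥ 0≤+ {2} ≥*≥ 0≤d ≥*≥ 0≤d ≥+≥ 0≤+ {5} ≥*≥ 0≤d ≥+≥ 0≤+ {1}))))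

  2q+d+3∉S : ¬ InS (Γ q) d (+ 2 * + q + d + + 3)
  2q+d+3∉S (_ , _ , R≥0) = 0<-i⇒i≱0 (R-at-2q+d+3 (+ q) d)
    ((((0≤+ {2} ≥*≥ 0≤d ≥+≥ 0≤+ {2}) ≥*≥ 0≤s
       ≥+≥ (0≤+ {8} ≥*≥ 0≤d ≥*≥ 0≤d ≥+≥ 0≤+ {22} ≥*≥ 0≤d ≥+≥ 0≤+ {10})) ≥*≥ 0≤s
      ≥+≥ (0≤+ {8} ≥*≥ 0≤d ≥*≥ 0≤d ≥*≥ 0≤d ≥+≥ 0≤+ {38} ≥*≥ 0≤d ≥*≥ 0≤d
           ≥+≥ 0≤+ {52} ≥*≥ 0≤d ≥+≥ 0≤+ {14})) ≥*≥ 0≤s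
     ≥+≥ (0≤+ {4} ≥*≥ 0≤d ≥*≥ 0≤d ≥*≥ 0≤d ≥+≥ 0≤+ {22} ≥*≥ 0≤d ≥*≥ 0≤d ≥+≥ 0≤+ {32} ≥*≥ 0≤d)
     ≥+> +<+ {0} {6} z<s)
    (R≥0 (+ 2 * + q + d - + 2))

  -- Both factors of `E-Γ` are positive: the first is written around y = 2q + d + 4, where its value
  -- is q s + 2d + 8, and the second because p² > d.
  ≥2q+d+4⇒∉S : ∀ y → + 2 * + q + d + + 4 ≤ y → ¬ InS (Γ q) d y
  ≥2q+d+4⇒∉S y 2q+d+4≤y =
    E>0⇒∉S (Γ q) y d 0<y 0<k-d
      (subst (+ 0 <_) (sym (E-Γ (+ q) y d))
        (((0≤p² ≥+≥ 0≤+ {1}) ≥*≥ i≤j⇒0≤j-i 2q+d+4≤y ≥+≥ 0≤q ≥*≥ 0≤s ≥+≥ 0≤+ {2} ≥*≥ 0≤d ≥+> +<+ z<s)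
         -- The summands are swapped because `_≥+>_` wants the strictly positive one, here q² (p² -
         -- d), on the right.
         >*> subst (+ 0 <_) (+-comm (p ℤ.^ 2 * y) _)
               (0≤p² ≥*≥ <⇒≤ 0<y ≥+> 0<q >*> (0<q >*> +<+ z<s) >*> 0<p²-d)))
    where
    0<y : + 0 < y
    0<y = <-≤-trans (0≤+ {2} ≥*≥ 0≤q ≥+≥ 0≤d ≥+> +<+ {0} {4} z<s) 2q+d+4≤y

  ∈S⇒<2q+d+3 : ∀ y → InS (Γ q) d y → y < + 2 * + q + d + + 3
  ∈S⇒<2q+d+3 y y∈S = ≤∧≢⇒< (≮⇒≥ b≮y) (λ y≡b → 2q+d+3∉S (subst (InS (Γ q) d) y≡b y∈S))
    where
    shift : ∀ i → + 1 + (i + + 3) ≡ i + + 4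
    shift = solve-∀
    b≮y : ¬ (+ 2 * + q + d + + 3 < y)
    b≮y b<y = ≥2q+d+4⇒∉S y (subst (_≤ y) (shift (+ 2 * + q + d)) (i<j⇒suc[i]≤j b<y)) y∈S

  Rab<⌊Haem⌋ : ∀ r → RabIs (Γ q) d r → r < ℚ.floor (Haem (Γ q) d)
  Rab<⌊Haem⌋ r (inj₁ (r∈S , _)) = <-≤-trans (∈S⇒<2q+d+3 r r∈S) 2q+d+3≤⌊Haem⌋
  -- S_d is empty and the bound takes its default 0, which lies below 2q + d + 3.
  Rab<⌊Haem⌋ r (inj₂ (_ , refl)) =
    <-≤-trans (0≤+ {2} ≥*≥ 0≤q ≥+≥ 0≤d ≥+> +<+ {0} {3} z<s) 2q+d+3≤⌊Haem⌋

-- Choosing q among the powers of 2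

n<2^n : ∀ n → n ℕ.< 2 ℕ.^ n
n<2^n zero    = z<s
n<2^n (suc n) = ℕP.+-mono-≤ (ℕP.m^n>0 2 n) (subst (n ℕ.<_) (sym (ℕP.+-identityʳ _)) (n<2^n n))

theorem6p15 : (Λ : ℚ) → 0ℚ ℚ.< Λ → (N : ℕ) →
    Σ ℕ λ q → (N ℕ.< q) × IsPrimePower q ×
    ((d : ℤ) → + 0 ℤ.≤ d → fromℤ d ℚ.≤ Λ →
    (r : ℤ) → RabIs (Γ q) d r → r ℤ.< ℚ.floor (Haem (Γ q) d))
theorem6p15 Λ _ N =
  q , ℕP.≤-<-trans (ℕP.m≤m+n N _) n<q , (2 , n , prime[2] , refl) ,
  λ d 0≤d d≤Λ → Rab<⌊Haem⌋ q d 0≤d (2d+4≤q d (fromℤ≤⇒≤∣↥∣ d Λ 0≤d d≤Λ))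
  where
  D = ∣ ↥ Λ ∣
  -- One q must exceed N and satisfy q ≥ 2d + 4 for all admissible d at once; every such d is at
  -- most D.
  n = N ℕ.+ (2 ℕ.* D ℕ.+ 4)
  -- The exponent is a successor to fit `IsPrimePower`.
  q = 2 ℕ.^ suc n
  n<q : n ℕ.< q
  n<q = ℕP.<-trans (ℕP.n<1+n n) (n<2^n (suc n))
  2d+4≤q : ∀ d → d ≤ + D → + 2 * d + + 4 ≤ + q
  2d+4≤q d d≤D = ≤-trans (+-monoˡ-≤ (+ 4) (*-monoˡ-≤-nonNeg (+ 2) d≤D))
    (subst (λ i → i + + 4 ≤ + q) (pos-* 2 D)
      (+≤+ (ℕP.≤-trans (ℕP.m≤n+m _ N) (ℕP.<⇒≤ n<q))))
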